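{- Let $G$ be a finite, simple, undirected, connected graph that is $C_4$-free (i.e., $G$ contains no cycle of length four as a not necessarily induced subgraph), has order $n$, diameter $d$, and edge-connectivity $\lambda \geq 4$. Then $$d \leq \frac{n-3}{3}.$$
   Context: The edge-connectivity of a graph is the minimum number of edges whose removal disconnects it. -}

module Defs where

open import Data.Nat using (ℕ; zero; suc; _≤_; _<_)
open import Data.Fin using (Fin)
open import Data.Product using (Σ; ∃; _×_; _,_)
open import Data.Sum using (_⊎_)
open import Data.Empty using (⊥)
open import Data.List using (List; length)
open import Data.List.Membership.Propositional using (_∈_)
open import Relation.Nullary using (¬_; Dec)
open import Relation.Binary.PropositionalEquality using (_≡_)

record Graph (n : ℕ) : Set₁ where
  field
    Adj    : Fin n → Fin n → Set
    adj?   : ∀ u v → Dec (Adj u v)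
    sym    : ∀ {u v} → Adj u v → Adj v u
    irrefl : ∀ {u} → ¬ Adj u u

module _ {n : ℕ} where

  data Walk (A : Fin n → Fin n → Set) : Fin n → Fin n → ℕ → Set where
    nil  : ∀ {u} → Walk A u u zero
    cons : ∀ {u v w k} → A u v → Walk A v w k → Walk A u w (suc k)

  ConnectedRel : (Fin n → Fin n → Set) → Set
  ConnectedRel A = ∀ u v → ∃ λ k → Walk A u v k

Connected : ∀ {n} → Graph n → Set
Connected G = ConnectedRel (Graph.Adj G)

HasDiameter : ∀ {n} → Graph n → ℕ → Set
HasDiameter {n} G d =
  (∀ u v → ∃ λ k → k ≤ d × Walk (Graph.Adj G) u v k)
  × (Σ (Fin n) λ u → Σ (Fin n) λ v → ∀ k → Walk (Graph.Adj G) u v k → d ≤ k)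

C4Free : ∀ {n} → Graph n → Set
C4Free {n} G = (a b c e : Fin n) →
  ¬ (a ≡ c) → ¬ (b ≡ e) →
  Adj a b → Adj b c → Adj c e → Adj e a → ⊥
  where open Graph G

RemoveEdges : ∀ {n} → Graph n → List (Fin n × Fin n) → Fin n → Fin n → Set
RemoveEdges G F u v = Graph.Adj G u v × ¬ ((u , v) ∈ F ⊎ (v , u) ∈ F)

IsEdgeConnectivity : ∀ {n} → Graph n → ℕ → Set
IsEdgeConnectivity {n} G k =
  (Σ (List (Fin n × Fin n)) λ F → length F ≡ k × ¬ ConnectedRel (RemoveEdges G F))
  × (∀ (F : List (Fin n × Fin n)) → length F < k → ConnectedRel (RemoveEdges G F))

{-# OPTIONS --safe #-}

-- Let s₀, …, s_d be the sizes of the distance layers from an end of a diametral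
-- pair.  Edge-connectivity 4 gives at least four edges between consecutive layers
-- and minimum degree 4; C₄-freeness says that two vertices have at most one common
-- neighbour.  Hence a layer of size 1 is followed by two layers of size at least 4,
-- and a layer of size 2 by a layer of size at least 4, possibly after one of size 3.
-- Read from left to right the sizes thus split into blocks
--   (≥3),  (2,≥4),  (2,3,≥4),  (1,≥4,≥4)
-- of average at least 3.  Only a last layer of size 1 or 2 remains; it is preceded
-- by layers large enough for the earlier blocks to have the missing surplus.
module Submission where

open import Defs
open import Data.Nat using (ℕ; zero; suc; _≤_; _<_; _+_; _*_; z≤n; s≤s; z<s; _≤?_; _<?_)
import Data.Nat as ℕ
open import Data.Nat.Properties using (≤-refl; ≤-reflexive; ≤-trans; ≤-antisym; ≤-pred; <-irrefl; <⇒≤; <⇒≢; ≮⇒≥; n≤0⇒n≡0; 1+n≢n; m≤n⇒m≤1+n; m≤n⇒m<n∨m≡n; m≤m+n; +-suc; +-monoʳ-≤; +-mono-≤; +-cancelʳ-≤; 1+n≰n)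
open import Data.Nat.Tactic.RingSolver using (solve-∀)
open import Data.Fin using (Fin; _≟_)
open import Data.Fin.Properties using (any?)
open import Data.Product using (Σ; ∃; ∃₂; _×_; _,_; proj₁; proj₂)
open import Data.Sum using (_⊎_; inj₁; inj₂; [_,_]′)
open import Data.Empty using (⊥; ⊥-elim)
open import Data.List using (List; []; _∷_; _++_; length; map; filter; allFin)
open import Data.List.Properties using (length-map; length-++; length-tabulate)
open import Data.List.Membership.Propositional using (_∈_; _∉_)
open import Data.List.Membership.Propositional.Properties using (∈-map⁺; ∈-++⁺ˡ; ∈-++⁺ʳ; ∈-++⁻; ∈-∃++; ∈-filter⁺; ∈-filter⁻; ∈-allFin)
open import Data.List.Relation.Binary.Subset.Propositional using (_⊆_)
open import Data.List.Relation.Unary.All as All using (All; []; _∷_)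
open import Data.List.Relation.Unary.All.Properties using (¬Any⇒All¬; All¬⇒¬Any; ++⁺)
open import Data.List.Relation.Unary.AllPairs using ([]; _∷_)
open import Data.List.Relation.Unary.Any using (here; there)
open import Data.List.Relation.Unary.Unique.Propositional using (Unique)
import Data.List.Relation.Unary.Unique.Propositional.Properties as Unique
open import Relation.Binary.PropositionalEquality using (_≡_; _≢_; refl; sym; trans; cong; cong₂; subst)
open import Relation.Nullary using (¬_; Dec; yes; no; ¬?; contradiction)
open import Relation.Nullary.Decidable using (map′; _×-dec_)
open import Function using (_∘_)

least : {P : ℕ → Set} → (∀ k → Dec (P k)) → ∀ k → P k → ∃ λ m → P m × (∀ j → P j → m ≤ j)
least P? k p with P? 0
least P? k p | yes p₀ = 0 , p₀ , λ _ _ → z≤n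
least P? zero p | no ¬p₀ = contradiction p ¬p₀
least {P} P? (suc k) p | no ¬p₀ with least (P? ∘ suc) k p
... | m , pm , min = suc m , pm , min′
  where
  min′ : ∀ j → P j → suc m ≤ j
  min′ zero    q = contradiction q ¬p₀
  min′ (suc j) q = s≤s (min j q)

-- Lists of distinct elements

length-mono-⊆ : {A : Set} {xs ys : List A} → Unique xs → xs ⊆ ys → length xs ≤ length ys
length-mono-⊆ {xs = []} _ _ = z≤n
length-mono-⊆ {xs = x ∷ xs} (x∉xs ∷ uxs) sub with ∈-∃++ (sub (here refl))
... | ls , rs , refl = ≤-trans (s≤s (length-mono-⊆ uxs sub′)) (≤-reflexive len)
  where
  sub′ : xs ⊆ ls ++ rs
  sub′ y∈xs with ∈-++⁻ ls (sub (there y∈xs))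
  ... | inj₁ y∈ls         = ∈-++⁺ˡ y∈ls
  ... | inj₂ (here refl)  = contradiction y∈xs (All¬⇒¬Any x∉xs)
  ... | inj₂ (there y∈rs) = ∈-++⁺ʳ ls y∈rs
  len : suc (length (ls ++ rs)) ≡ length (ls ++ x ∷ rs)
  len = trans (cong suc (length-++ ls)) (trans (sym (+-suc (length ls) (length rs))) (sym (length-++ ls)))

-- Lower bounds on cardinality are carried by explicit lists of distinct elements, so `P` may be any
-- predicate, decidable or not.
AtLeast : {A : Set} → ℕ → (A → Set) → Set
AtLeast k P = ∃ λ xs → length xs ≡ k × Unique xs × All P xs

-- Greedy choice. The hypothesis has the shape of what edge-connectivity yields: fewer than `k`
-- forbidden objects always leave another one.
grow : {A : Set} {P : A → Set} (k : ℕ) → (∀ xs → length xs < k → ∃ λ x → P x × x ∉ xs) → AtLeast k P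
grow zero _ = [] , refl , [] , []
grow (suc k) fresh with grow k (λ xs lt → fresh xs (m≤n⇒m≤1+n lt))
... | xs , len , uxs , pxs with fresh xs (s≤s (≤-reflexive len))
... | x , px , x∉xs = x ∷ xs , cong suc len , ¬Any⇒All¬ xs x∉xs ∷ uxs , px ∷ pxs

AtLeast-map : {A : Set} {P Q : A → Set} {k : ℕ} → (∀ {x} → P x → Q x) → AtLeast k P → AtLeast k Q
AtLeast-map f (xs , len , uxs , pxs) = xs , len , uxs , All.map f pxs

AtLeast-one : {A : Set} {P : A → Set} {x : A} → P x → AtLeast 1 P
AtLeast-one {x = x} px = x ∷ [] , refl , [] ∷ [] , px ∷ []

AtLeast-∪ : {A : Set} {P Q R : A → Set} {j k : ℕ} →
  (∀ {x} → P x → R x) → (∀ {x} → Q x → R x) → (∀ {x} → P x → Q x → ⊥) →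
  AtLeast j P → AtLeast k Q → AtLeast (j + k) R
AtLeast-∪ f g disj (xs , lx , ux , px) (ys , ly , uy , py) =
  xs ++ ys , trans (length-++ xs) (cong₂ _+_ lx ly) ,
  Unique.++⁺ ux uy (λ (v∈xs , v∈ys) → disj (All.lookup px v∈xs) (All.lookup py v∈ys)) ,
  ++⁺ (All.map f px) (All.map g py)

-- The fibres `R y` are disjoint by injectivity, so their sizes add up. In the applications
-- injectivity is an instance of C₄-freeness.
AtLeast-⋃ : {A : Set} {P Q : A → Set} (R : A → A → Set) {m k : ℕ} →
  (∀ {y x} → P y → R y x → Q x) → (∀ {y y′ x} → P y → P y′ → R y x → R y′ x → y ≡ y′) →
  (∀ {y} → P y → AtLeast m (R y)) → AtLeast k P → AtLeast (k * m) Q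
AtLeast-⋃ {P = P} {Q} R {m} f inj fan (ys , refl , uys , pys) =
  AtLeast-map (λ (y , y∈ys , r) → f (All.lookup pys y∈ys) r) (go ys uys pys)
  where
  go : ∀ ys → Unique ys → All P ys → AtLeast (length ys * m) (λ x → ∃ λ y → y ∈ ys × R y x)
  go [] _ _ = [] , refl , [] , []
  go (y ∷ ys) (y∉ys ∷ uys) (py ∷ pys) =
    AtLeast-∪ (λ r → y , here refl , r) (λ (y′ , y′∈ys , r) → y′ , there y′∈ys , r)
      (λ r (y′ , y′∈ys , r′) → All.lookup y∉ys y′∈ys (inj py (All.lookup pys y′∈ys) r r′))
      (fan py) (go ys uys pys)

-- Distances

module _ {n : ℕ} (G : Graph n) where
  open Graph G renaming (sym to adj-sym)

  walk? : ∀ k u v → Dec (Walk Adj u v k)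
  walk? zero u v = map′ (λ { refl → nil }) (λ { nil → refl }) (u ≟ v)
  walk? (suc k) u v =
    map′ (λ (_ , a , w) → cons a w) (λ { (cons a w) → _ , a , w })
      (any? (λ w → adj? u w ×-dec walk? k w v))

  -- Walks are oriented towards the root `u`, so the first edge of a shortest walk leads to a vertex
  -- one layer closer.
  record Distance (u : Fin n) : Set where
    field
      dist        : Fin n → ℕ
      dist-walk   : ∀ w → Walk Adj w u (dist w)
      dist-least  : ∀ w k → Walk Adj w u k → dist w ≤ k

    dist-root : dist u ≡ 0
    dist-root = n≤0⇒n≡0 (dist-least u 0 nil)

    dist≡0⇒root : ∀ {w} → dist w ≡ 0 → w ≡ u
    dist≡0⇒root {w} eq with subst (Walk Adj w u) eq (dist-walk w)
    ... | nil = refl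

    dist-adj : ∀ {p q} → Adj p q → dist p ≤ suc (dist q)
    dist-adj a = dist-least _ _ (cons a (dist-walk _))

    parent : ∀ {w k} → dist w ≡ suc k → ∃ λ p → Adj w p × dist p ≡ k
    parent {w} eq with subst (Walk Adj w u) eq (dist-walk w)
    ... | cons a t = _ , a , ≤-antisym (dist-least _ _ t) (≤-pred (subst (_≤ suc (dist _)) eq (dist-adj a)))

    neighbour-layer : ∀ {p q i} → dist p ≡ suc i → Adj p q →
      dist q ≡ i ⊎ dist q ≡ suc i ⊎ dist q ≡ suc (suc i)
    neighbour-layer {p} {q} eq a
      with m≤n⇒m<n∨m≡n (subst (λ k → dist q ≤ suc k) eq (dist-adj (adj-sym a)))
         | m≤n⇒m<n∨m≡n (≤-pred (subst (_≤ suc (dist q)) eq (dist-adj a)))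
    ... | inj₂ e | _ = inj₂ (inj₂ e)
    ... | inj₁ _ | inj₂ e = inj₁ (sym e)
    ... | inj₁ l | inj₁ g = inj₂ (inj₁ (≤-antisym (≤-pred l) g))

  distance : Connected G → ∀ u → Distance u
  distance conn u = record
    { dist       = λ w → proj₁ (shortest w)
    ; dist-walk  = λ w → proj₁ (proj₂ (shortest w))
    ; dist-least = λ w → proj₂ (proj₂ (shortest w)) }
    where
    shortest : ∀ w → ∃ λ m → Walk Adj w u m × (∀ k → Walk Adj w u k → m ≤ k)
    shortest w = least (λ k → walk? k w u) (proj₁ (conn w u)) (proj₂ (conn w u))

  -- The value is arbitrary when there is no common neighbour.
  common : Fin n → Fin n → Fin n
  common a b with any? (λ w → adj? a w ×-dec adj? b w)
  ... | yes (c , _) = c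
  ... | no _        = a

-- Common neighbours, surviving edges and distance layers.

module Layers {n : ℕ} (G : Graph n) (c4-free : C4Free G)
  (robust : ∀ F → length F < 4 → ConnectedRel (RemoveEdges G F))
  {u v : Fin n} (D : Distance G u) {d : ℕ} (0<d : 0 < d)
  (dist≤d : ∀ w → Distance.dist D w ≤ d) (dist-v : Distance.dist D v ≡ d) where

  open Graph G renaming (sym to adj-sym)
  open Distance D

  -- A second common neighbour `c` would close the four-cycle `a`, `w`, `b`, `c`. As `common G a b`
  -- is always a definite vertex, it can be put on a list of vertices to avoid without asking
  -- whether a common neighbour exists.
  common-unique : ∀ {a b w} → a ≢ b → Adj a w → Adj b w → w ≡ common G a b
  common-unique {a} {b} {w} a≢b aw bw with any? (λ w → adj? a w ×-dec adj? b w)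
  ... | no ¬c = contradiction (w , aw , bw) ¬c
  ... | yes (c , ac , bc) with w ≟ c
  ...   | yes eq = eq
  ...   | no w≢c = ⊥-elim (c4-free a w b c a≢b w≢c aw (adj-sym bw) bc (adj-sym ac))

  common₂ : ∀ {a b w w′} → a ≢ b → Adj a w → Adj b w → Adj a w′ → Adj b w′ → w ≡ w′
  common₂ a≢b aw bw aw′ bw′ = trans (common-unique a≢b aw bw) (sym (common-unique a≢b aw′ bw′))

  other-vertex : ∀ x → ∃ λ t → x ≢ t
  other-vertex x with x ≟ u
  ... | no x≢u   = u , x≢u
  ... | yes refl = v , λ x≡v → <⇒≢ 0<d (trans (sym dist-root) (trans (cong dist x≡v) dist-v))

  -- Minimum degree 4 in usable form: after deletion of the edges from `x` to `L`, `x` is still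
  -- joined to another vertex, and the first edge of a walk there leads outside `L`.
  neighbour-avoiding : ∀ x L → length L < 4 → ∃ λ w → Adj x w × w ∉ L
  neighbour-avoiding x L lt with other-vertex x
  ... | t , x≢t = first (proj₂ (robust F (subst (_< 4) (sym (length-map (x ,_) L)) lt) x t)) x≢t
    where
    F = map (x ,_) L
    first : ∀ {t k} → Walk (RemoveEdges G F) x t k → x ≢ t → ∃ λ w → Adj x w × w ∉ L
    first nil x≢x = contradiction refl x≢x
    first (cons (a , ∉F) _) _ = _ , a , λ w∈L → ∉F (inj₁ (∈-map⁺ (x ,_) w∈L))

  -- A walk from `v` to `u` avoiding `F` starts in layer `d` and ends in layer 0; the edge sought is
  -- the one by which it first drops to distance at most `i`.
  crossing-edge : ∀ {i} → i < d → ∀ F → length F < 4 →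
    ∃₂ λ p q → dist p ≡ i × dist q ≡ suc i × Adj p q × (p , q) ∉ F
  crossing-edge {i} i<d F lt = go (proj₂ (robust F lt v u)) (subst (i <_) (sym dist-v) i<d)
    where
    go : ∀ {w k} → Walk (RemoveEdges G F) w u k → i < dist w →
      ∃₂ λ p q → dist p ≡ i × dist q ≡ suc i × Adj p q × (p , q) ∉ F
    go nil i<0 = contradiction (subst (i <_) dist-root i<0) λ ()
    go {w} (cons {v = p} (a , ∉F) t) i<w with i <? dist p
    ... | yes i<p = go t i<p
    -- The walk uses this edge downwards, from `w` to `p`; `inj₂` is the reversed orientation, which
    -- `RemoveEdges` also excludes.
    ... | no i≮p = p , w , dp , dw , adj-sym a , λ e → ∉F (inj₂ e)
      where
      p≤i = ≮⇒≥ i≮p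
      dp = ≤-antisym p≤i (≤-pred (≤-trans i<w (dist-adj a)))
      dw = ≤-antisym (≤-trans (dist-adj a) (s≤s p≤i)) i<w

  layer : ℕ → List (Fin n)
  layer i = filter (λ w → dist w ℕ.≟ i) (allFin n)

  layer-unique : ∀ i → Unique (layer i)
  layer-unique i = Unique.filter⁺ (λ w → dist w ℕ.≟ i) (Unique.allFin⁺ n)

  ∈-layer : ∀ {w i} → dist w ≡ i → w ∈ layer i
  ∈-layer {w} {i} = ∈-filter⁺ (λ w → dist w ℕ.≟ i) (∈-allFin w)

  ∈-layer⁻ : ∀ {w i} → w ∈ layer i → dist w ≡ i
  ∈-layer⁻ {i = i} w∈ = proj₂ (∈-filter⁻ (λ w → dist w ℕ.≟ i) {xs = allFin n} w∈)

  size : ℕ → ℕ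
  size i = length (layer i)

  -- Layer `i` itself is not counted, so `total (suc d)` covers the layers from 0 to `d`.
  total : ℕ → ℕ
  total zero    = 0
  total (suc i) = total i + size i

  InLayer : ℕ → Fin n → Set
  InLayer i w = dist w ≡ i

  size-≥ : ∀ {k i} → AtLeast k (InLayer i) → k ≤ size i
  size-≥ (xs , refl , uxs , pxs) = length-mono-⊆ uxs (λ x∈xs → ∈-layer (All.lookup pxs x∈xs))

  total≤n : ∀ m → total m ≤ n
  total≤n m with prefix m
    where
    prefix : ∀ m → AtLeast (total m) (λ w → dist w < m)
    prefix zero    = [] , refl , [] , []
    prefix (suc m) = AtLeast-∪ m≤n⇒m≤1+n (s≤s ∘ ≤-reflexive) (λ lt eq → <-irrefl eq lt)
      (prefix m) (layer m , refl , layer-unique m , All.tabulate ∈-layer⁻)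
  ... | xs , len , uxs , _ =
    ≤-trans (≤-reflexive (sym len)) (≤-trans (length-mono-⊆ {ys = allFin n} uxs (λ {x} _ → ∈-allFin x))
      (≤-reflexive (length-tabulate {n = n} (λ i → i))))

  size-one : ∀ {i} → size i ≡ 1 → ∃ λ x → dist x ≡ i × (∀ {w} → dist w ≡ i → w ≡ x)
  size-one {i} eq with layer i | (λ w → ∈-layer⁻ {w} {i}) | (λ w → ∈-layer {w} {i})
  ... | x ∷ [] | elem | mem = x , elem _ (here refl) , λ dw → only (mem _ dw)
    where
    only : ∀ {w} → w ∈ x ∷ [] → w ≡ x
    only (here e) = e

  size-two : ∀ {i} → size i ≡ 2 →
    ∃₂ λ a b → a ≢ b × dist a ≡ i × dist b ≡ i × (∀ {w} → dist w ≡ i → w ≡ a ⊎ w ≡ b)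
  size-two {i} eq with layer i | layer-unique i | (λ w → ∈-layer⁻ {w} {i}) | (λ w → ∈-layer {w} {i})
  ... | a ∷ b ∷ [] | (a≢b ∷ []) ∷ _ | elem | mem =
    a , b , a≢b , elem _ (here refl) , elem _ (there (here refl)) , λ dw → only (mem _ dw)
    where
    only : ∀ {w} → w ∈ a ∷ b ∷ [] → w ≡ a ⊎ w ≡ b
    only (here e)         = inj₁ e
    only (there (here e)) = inj₂ e

  size-root : size 0 ≡ 1
  size-root = ≤-antisym
    (length-mono-⊆ {ys = u ∷ []} (layer-unique 0) (λ w∈ → here (dist≡0⇒root (∈-layer⁻ w∈))))
    (size-≥ (AtLeast-one dist-root))

  -- Rules out a block that would have to continue past layer `d`.
  size-beyond : size (suc d) ≡ 0
  size-beyond = n≤0⇒n≡0 (length-mono-⊆ {ys = []} (layer-unique (suc d))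
    (λ {w} w∈ → contradiction (subst (_≤ d) (∈-layer⁻ w∈) (dist≤d w)) 1+n≰n))

  size-positive : ∀ {i} → i ≤ d → 1 ≤ size i
  size-positive i≤d with m≤n⇒m<n∨m≡n i≤d
  ... | inj₂ refl = size-≥ (AtLeast-one dist-v)
  ... | inj₁ i<d with crossing-edge i<d [] (s≤s z≤n)
  ...   | p , _ , dp , _ = size-≥ (AtLeast-one dp)

  layers-≢ : ∀ {p q i j} → dist p ≡ i → dist q ≡ j → i ≢ j → p ≢ q
  layers-≢ refl refl i≢j refl = i≢j refl

  -- Layers of size one

  -- All edges to the next layer start at `x`, so different crossing edges have different heads;
  -- forbidding the edges to the heads found so far yields a new one.
  four-after-one : ∀ {i} → i < d → size i ≡ 1 → AtLeast 4 (InLayer (suc i))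
  four-after-one i<d s≡1 with size-one s≡1
  ... | x , dx , only = grow 4 λ L lt →
    let p , q , dp , dq , _ , ∉F = crossing-edge i<d (map (x ,_) L) (subst (_< 4) (sym (length-map (x ,_) L)) lt)
    in q , dq , λ q∈L → ∉F (subst (λ z → (z , q) ∈ map (x ,_) L) (sym (only dp)) (∈-map⁺ (x ,_) q∈L))

  one-next : ∀ {i} → i < d → size i ≡ 1 → 4 ≤ size (suc i)
  one-next i<d s≡1 = size-≥ (four-after-one i<d s≡1)

  -- The layer after x consists of neighbours of x, so each of its vertices has at
  -- most one neighbour inside it, and no two of them a common neighbour but x.
  one-next-next : ∀ {i} → i < d → size i ≡ 1 → 4 ≤ size (suc (suc i))
  one-next-next {i} i<d s≡1 with size-one s≡1
  ... | x , dx , only =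
    size-≥ (AtLeast-⋃ (λ y w → Adj y w × dist w ≡ suc (suc i)) {m = 1} (λ _ → proj₂) inj fan
      (four-after-one i<d s≡1))
    where
    adj-x : ∀ {y} → dist y ≡ suc i → Adj x y
    adj-x dy with parent dy
    ... | p , yp , dp = subst (λ z → Adj z _) (only dp) (adj-sym yp)
    inj : ∀ {y y′ w} → dist y ≡ suc i → dist y′ ≡ suc i →
      Adj y w × dist w ≡ suc (suc i) → Adj y′ w × dist w ≡ suc (suc i) → y ≡ y′
    inj dy dy′ (yw , dw) (y′w , _) =
      common₂ (layers-≢ dx dw λ ()) (adj-x dy) (adj-sym yw) (adj-x dy′) (adj-sym y′w)
    fan : ∀ {y} → dist y ≡ suc i → AtLeast 1 (λ w → Adj y w × dist w ≡ suc (suc i))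
    fan {y} dy with neighbour-avoiding y (x ∷ common G x y ∷ []) (s≤s (s≤s (s≤s z≤n)))
    ... | w , yw , w∉ with neighbour-layer dy yw
    ...   | inj₁ dw        = contradiction (here (only dw)) w∉
    ...   | inj₂ (inj₁ dw) = contradiction (there (here (common-unique (layers-≢ dx dy λ ()) (adj-x dw) yw))) w∉
    ...   | inj₂ (inj₂ dw) = AtLeast-one (yw , dw)

  -- Layers of size two

  module AfterTwo {i : ℕ} (i<d : i < d) {a b : Fin n} (a≢b : a ≢ b)
    (only : ∀ {w} → dist w ≡ i → w ≡ a ⊎ w ≡ b) where

    private
      -- The only vertex that can be adjacent to both `a` and `b`. At most two edges from layer `i`
      -- end in it, and any other vertex has at most one neighbour in that layer.
      c : Fin n
      c = common G a b

    record Crossing : Set where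
      field
        {tail head} : Fin n
        tail-layer  : dist tail ≡ i
        head-layer  : dist head ≡ suc i
        edge        : Adj tail head

    open Crossing

    crossing-avoiding : ∀ F → length F < 4 → Σ Crossing λ e → (tail e , head e) ∉ F
    crossing-avoiding F lt with crossing-edge i<d F lt
    ... | p , q , dp , dq , pq , ∉F = record { tail-layer = dp ; head-layer = dq ; edge = pq } , ∉F

    one-of : ∀ {r r′ r″} → dist r ≡ i → dist r′ ≡ i → dist r″ ≡ i → r′ ≢ r″ → r ≡ r′ ⊎ r ≡ r″
    one-of dr dr′ dr″ ne with only dr | only dr′ | only dr″
    ... | inj₁ e | inj₁ e′ | _       = inj₁ (trans e (sym e′))
    ... | inj₂ e | inj₂ e′ | _       = inj₁ (trans e (sym e′))
    ... | inj₁ e | inj₂ _  | inj₁ e″ = inj₂ (trans e (sym e″))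
    ... | inj₂ e | inj₁ _  | inj₂ e″ = inj₂ (trans e (sym e″))
    ... | inj₁ _ | inj₂ e′ | inj₂ e″ = contradiction (trans e′ (sym e″)) ne
    ... | inj₂ _ | inj₁ e′ | inj₁ e″ = contradiction (trans e′ (sym e″)) ne

    two-parents : ∀ {r r′ q} → dist r ≡ i → dist r′ ≡ i → r ≢ r′ → Adj r q → Adj r′ q → q ≡ c
    two-parents dr dr′ ne rq r′q with only dr | only dr′
    ... | inj₁ refl | inj₁ refl = contradiction refl ne
    ... | inj₁ refl | inj₂ refl = common-unique a≢b rq r′q
    ... | inj₂ refl | inj₁ refl = common-unique a≢b r′q rq
    ... | inj₂ refl | inj₂ refl = contradiction refl ne

    head≢c : ∀ {F} (e : Crossing) → (tail e , head e) ∉ (a , c) ∷ (b , c) ∷ F → head e ≢ c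
    head≢c e ∉F refl with only (tail-layer e)
    ... | inj₁ refl = ∉F (here refl)
    ... | inj₂ refl = ∉F (there (here refl))

    -- If the heads agreed, equal tails would make the edges equal, and different tails would be two
    -- parents of a head other than `c`.
    head-fresh : (e e′ : Crossing) → head e ≢ c → (tail e′ , head e′) ≢ (tail e , head e) → head e′ ≢ head e
    head-fresh e e′ h≢c ne eq with tail e′ ≟ tail e
    ... | yes t≡t = ne (cong₂ _,_ t≡t eq)
    ... | no t≢t  = h≢c (two-parents (tail-layer e) (tail-layer e′) (t≢t ∘ sym) (edge e)
                          (subst (Adj (tail e′)) eq (edge e′)))

    -- A head other than c has only one parent, so any further edge has another head.
    record ThreeHeads : Set where
      field
        e₁ e₂ e₃ : Crossing
        h₁≢c     : head e₁ ≢ c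
        h₂≢c     : head e₂ ≢ c
        h₂≢h₁    : head e₂ ≢ head e₁
        h₃≢h₁    : head e₃ ≢ head e₁
        h₃≢h₂    : head e₃ ≢ head e₂

    three-heads : ThreeHeads
    three-heads =
      let e₁ , ∉₁ = crossing-avoiding ((a , c) ∷ (b , c) ∷ []) (s≤s (s≤s (s≤s z≤n)))
          h₁≢c    = head≢c e₁ ∉₁
          e₂ , ∉₂ = crossing-avoiding ((a , c) ∷ (b , c) ∷ (tail e₁ , head e₁) ∷ []) ≤-refl
          h₂≢c    = head≢c e₂ ∉₂
          -- Here `c` is not excluded: of the three heads only `head e₃` may be `c`.
          e₃ , ∉₃ = crossing-avoiding ((tail e₁ , head e₁) ∷ (tail e₂ , head e₂) ∷ []) (s≤s (s≤s (s≤s z≤n)))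
      in record
        { e₁ = e₁ ; e₂ = e₂ ; e₃ = e₃ ; h₁≢c = h₁≢c ; h₂≢c = h₂≢c
        ; h₂≢h₁ = head-fresh e₁ e₂ h₁≢c (λ eq → ∉₂ (there (there (here eq))))
        ; h₃≢h₁ = head-fresh e₁ e₃ h₁≢c (λ eq → ∉₃ (here eq))
        ; h₃≢h₂ = head-fresh e₂ e₃ h₂≢c (λ eq → ∉₃ (there (here eq))) }

    three-next : ThreeHeads → 3 ≤ size (suc i)
    three-next T = size-≥ (head e₃ ∷ head e₂ ∷ head e₁ ∷ [] , refl ,
      (h₃≢h₂ ∷ h₃≢h₁ ∷ []) ∷ (h₂≢h₁ ∷ []) ∷ [] ∷ [] ,
      head-layer e₃ ∷ head-layer e₂ ∷ head-layer e₁ ∷ [])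
      where open ThreeHeads T

    module _ (T : ThreeHeads) (s≡3 : size (suc i) ≡ 3) where

      open ThreeHeads T

      private
        x y z : Fin n
        x = head e₃
        y = head e₁
        z = head e₂

        dx = head-layer e₃
        dy = head-layer e₁
        dz = head-layer e₂

        Below : Fin n → Fin n → Set
        Below p w = Adj p w × dist w ≡ suc (suc i)

      one-of-heads : ∀ {w} → dist w ≡ suc i → w ≡ x ⊎ w ≡ y ⊎ w ≡ z
      one-of-heads {w} dw with w ≟ x | w ≟ y | w ≟ z
      ... | yes e | _ | _ = inj₁ e
      ... | no _ | yes e | _ = inj₂ (inj₁ e)
      ... | no _ | no _ | yes e = inj₂ (inj₂ e)
      ... | no w≢x | no w≢y | no w≢z = contradiction (subst (4 ≤_) s≡3 (size-≥
        (w ∷ x ∷ z ∷ y ∷ [] , refl ,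
         (w≢x ∷ w≢z ∷ w≢y ∷ []) ∷ (h₃≢h₂ ∷ h₃≢h₁ ∷ []) ∷ (h₂≢h₁ ∷ []) ∷ [] ∷ [] ,
         dw ∷ dx ∷ dz ∷ dy ∷ []))) 1+n≰n

      -- There are at least four edges into {x, y, z}, and y and z receive one each.
      x-parents : ∀ {r} → dist r ≡ i → Adj r x
      x-parents {r} dr
        with crossing-avoiding ((tail e₁ , y) ∷ (tail e₂ , z) ∷ (tail e₃ , x) ∷ []) ≤-refl
      ... | e₄ , ∉₄ with one-of-heads (head-layer e₄)
      ...   | inj₂ (inj₁ h≡y) = contradiction h≡y (head-fresh e₁ e₄ h₁≢c (λ eq → ∉₄ (here eq)))
      ...   | inj₂ (inj₂ h≡z) = contradiction h≡z (head-fresh e₂ e₄ h₂≢c (λ eq → ∉₄ (there (here eq))))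
      ...   | inj₁ h≡x with one-of dr (tail-layer e₃) (tail-layer e₄)
                              (λ t≡t → ∉₄ (there (there (here (cong₂ _,_ (sym t≡t) h≡x)))))
      ...     | inj₁ refl = edge e₃
      ...     | inj₂ refl = subst (Adj (tail e₄)) h≡x (edge e₄)

      -- Both x and the head of e′ are neighbours of the tail of e′, so the head of e
      -- is adjacent to at most one of them.
      below : (e e′ : Crossing) → head e ≢ c →
        (∀ {w} → dist w ≡ suc i → w ≡ x ⊎ w ≡ head e ⊎ w ≡ head e′) →
        ∀ L → length L < 2 → ∃ λ w → Below (head e) w × w ∉ L
      below e e′ h≢c heads L lt
        with neighbour-avoiding (head e) (tail e ∷ common G (head e) (tail e′) ∷ L) (s≤s (s≤s lt))
      ... | w , hw , w∉ with neighbour-layer (head-layer e) hw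
      ...   | inj₂ (inj₂ dw) = w , (hw , dw) , λ w∈L → w∉ (there (there w∈L))
      ...   | inj₁ dw with w ≟ tail e
      ...     | yes w≡t = contradiction (here w≡t) w∉
      ...     | no w≢t  = contradiction (two-parents dw (tail-layer e) w≢t (adj-sym hw) (edge e)) h≢c
      below e e′ h≢c heads L lt | w , hw , w∉ | inj₂ (inj₁ dw) =
        contradiction (there (here (common-unique (layers-≢ (head-layer e) (tail-layer e′) 1+n≢n) hw (parent-w (heads dw))))) w∉
        where
        parent-w : w ≡ x ⊎ w ≡ head e ⊎ w ≡ head e′ → Adj (tail e′) w
        parent-w (inj₁ refl)        = x-parents (tail-layer e′)
        parent-w (inj₂ (inj₁ refl)) = contradiction hw irrefl
        parent-w (inj₂ (inj₂ refl)) = edge e′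

      below-y : ∀ L → length L < 2 → ∃ λ w → Below y w × w ∉ L
      below-y = below e₁ e₂ h₁≢c one-of-heads

      below-z : ∀ L → length L < 2 → ∃ λ w → Below z w × w ∉ L
      below-z = below e₂ e₁ h₂≢c λ dw → swap₂ (one-of-heads dw)
        where
        swap₂ : ∀ {A B C : Set} → A ⊎ B ⊎ C → A ⊎ C ⊎ B
        swap₂ (inj₁ p)        = inj₁ p
        swap₂ (inj₂ (inj₁ p)) = inj₂ (inj₂ p)
        swap₂ (inj₂ (inj₂ p)) = inj₂ (inj₁ p)

      -- Two vertices below `y`, one below `z` but not adjacent to `y`, and `w`. If `y` or `z` were
      -- adjacent to `w`, it would share with `x` both `w` and its own parent, which is adjacent to
      -- `x` too.
      four-below-via-x : ∀ {w} → Below x w → AtLeast 4 (InLayer (suc (suc i)))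
      four-below-via-x {w} (xw , dw) with below-z (common G y z ∷ []) ≤-refl
      ... | t , (zt , dt) , t∉ =
        AtLeast-∪ {P = Below y} proj₂ proj₁ (λ (yq , _) (_ , ¬yq) → ¬yq yq) (grow 2 below-y)
          (t ∷ w ∷ [] , refl , (t≢w ∷ []) ∷ [] ∷ [] ,
           (dt , λ yt → t∉ (here (common-unique (h₂≢h₁ ∘ sym) yt zt))) ∷
           (dw , not-shared e₁ h₃≢h₁) ∷ [])
        where
        not-shared : (e : Crossing) → x ≢ head e → ¬ Adj (head e) w
        not-shared e x≢h hw = layers-≢ (tail-layer e) dw (λ ())
          (common₂ x≢h (adj-sym (x-parents (tail-layer e))) (adj-sym (edge e)) xw hw)
        t≢w : t ≢ w
        t≢w refl = not-shared e₂ h₃≢h₂ zt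

      -- As `x` is already the common neighbour of `y` and `z`, the two vertices below each are
      -- distinct.
      four-below-disjoint : Adj y x → Adj z x → AtLeast 4 (InLayer (suc (suc i)))
      four-below-disjoint yx zx =
        AtLeast-∪ {P = Below y} {Q = Below z} proj₂ proj₂
          (λ (yq , dq) (zq , _) → layers-≢ dx dq (λ ()) (common₂ (h₂≢h₁ ∘ sym) yx zx yq zq))
          (grow 2 below-y) (grow 2 below-z)

      neighbour-x-avoiding : ∀ p → ∃ λ w → Adj x w × w ≢ p × (dist w ≡ suc i ⊎ dist w ≡ suc (suc i))
      neighbour-x-avoiding p with neighbour-avoiding x (a ∷ b ∷ p ∷ []) ≤-refl
      ... | w , xw , w∉ = w , xw , (λ w≡p → w∉ (there (there (here w≡p)))) , level (neighbour-layer dx xw)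
        where
        level : dist w ≡ i ⊎ dist w ≡ suc i ⊎ dist w ≡ suc (suc i) → dist w ≡ suc i ⊎ dist w ≡ suc (suc i)
        level (inj₂ l) = l
        level (inj₁ dw) with only dw
        ... | inj₁ w≡a = contradiction (here w≡a) w∉
        ... | inj₂ w≡b = contradiction (there (here w≡b)) w∉

      -- Either `x` has a neighbour in layer `i + 2`, or its neighbours outside layer `i` are among
      -- `y` and `z`. In the latter case avoiding `y` finds `z` and avoiding `z` finds `y`, so `x`
      -- is adjacent to both.
      four-next : 4 ≤ size (suc (suc i))
      four-next with neighbour-x-avoiding y | neighbour-x-avoiding z
      ... | w , xw , _ , inj₂ dw | _ = size-≥ (four-below-via-x (xw , dw))
      ... | _ | w , xw , _ , inj₂ dw = size-≥ (four-below-via-x (xw , dw))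
      ... | w , xw , w≢y , inj₁ dw | w′ , xw′ , w′≢z , inj₁ dw′ with one-of-heads dw | one-of-heads dw′
      ...   | inj₁ refl | _ = contradiction xw irrefl
      ...   | inj₂ (inj₁ w≡y) | _ = contradiction w≡y w≢y
      ...   | _ | inj₁ refl = contradiction xw′ irrefl
      ...   | _ | inj₂ (inj₂ w′≡z) = contradiction w′≡z w′≢z
      ...   | inj₂ (inj₂ refl) | inj₂ (inj₁ refl) = size-≥ (four-below-disjoint (adj-sym xw′) (adj-sym xw))

  two-next : ∀ {i} → i < d → size i ≡ 2 → 3 ≤ size (suc i)
  two-next i<d s≡2 with size-two s≡2
  ... | _ , _ , a≢b , _ , _ , only = three-next three-heads
    where open AfterTwo i<d a≢b only

  two-three-next : ∀ {i} → i < d → size i ≡ 2 → size (suc i) ≡ 3 → 4 ≤ size (suc (suc i))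
  two-three-next i<d s≡2 with size-two s≡2
  ... | _ , _ , a≢b , _ , _ , only = four-next three-heads
    where open AfterTwo i<d a≢b only

  -- The last layer

  last-neighbour : ∀ {e p q} → suc e ≡ d → dist p ≡ suc e → Adj p q → dist q ≡ e ⊎ dist q ≡ suc e
  last-neighbour {q = q} refl dp pq with neighbour-layer dp pq
  ... | inj₁ dq        = inj₁ dq
  ... | inj₂ (inj₁ dq) = inj₂ dq
  ... | inj₂ (inj₂ dq) = contradiction (subst (_≤ d) dq (dist≤d q)) 1+n≰n

  -- Of four neighbours of `a` at most one is `b`, which leaves three in layer `e`. Of four
  -- neighbours of `b`, discarding `a` and the common neighbour leaves two more.
  last-two : ∀ {e} → suc e ≡ d → size (suc e) ≡ 2 → 5 ≤ size e
  last-two {e} e≡d s≡2 with size-two s≡2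
  ... | a , b , a≢b , da , db , only =
    size-≥ (AtLeast-∪ {P = λ w → Adj a w × dist w ≡ e} {Q = λ w → ¬ Adj a w × dist w ≡ e}
      proj₂ proj₂ (λ (aw , _) (¬aw , _) → ¬aw aw) (grow 3 from-a) (grow 2 from-b))
    where
    from-a : ∀ L → length L < 3 → ∃ λ w → (Adj a w × dist w ≡ e) × w ∉ L
    from-a L lt with neighbour-avoiding a (b ∷ L) (s≤s lt)
    ... | w , aw , w∉ with last-neighbour e≡d da aw
    ...   | inj₁ dw = w , (aw , dw) , λ w∈L → w∉ (there w∈L)
    ...   | inj₂ dw with only dw
    ...     | inj₁ refl = contradiction aw irrefl
    ...     | inj₂ w≡b  = contradiction (here w≡b) w∉
    from-b : ∀ L → length L < 2 → ∃ λ w → (¬ Adj a w × dist w ≡ e) × w ∉ L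
    from-b L lt with neighbour-avoiding b (a ∷ common G a b ∷ L) (s≤s (s≤s lt))
    ... | w , bw , w∉ with last-neighbour e≡d db bw
    ...   | inj₁ dw = w , ((λ aw → w∉ (there (here (common-unique a≢b aw bw)))) , dw) , λ w∈L → w∉ (there (there w∈L))
    ...   | inj₂ dw with only dw
    ...     | inj₁ w≡a  = contradiction (here w≡a) w∉
    ...     | inj₂ refl = contradiction bw irrefl

  -- If the layer before {x} has at most five vertices, at most one of them is not a
  -- neighbour of x, so three of the neighbours of x have all their neighbours but two
  -- in the layer before that; no vertex there is adjacent to two of them.
  last-one : ∀ {e} → suc (suc e) ≡ d → size (suc (suc e)) ≡ 1 → 6 ≤ size (suc e) ⊎ 6 ≤ size e
  last-one {e} e≡d s≡1 with 6 ≤? size (suc e)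
  ... | yes 6≤s = inj₁ 6≤s
  ... | no 6≰s with size-one s≡1
  ...   | x , dx , only =
    inj₂ (size-≥ (AtLeast-⋃ (λ y w → Adj y w × dist w ≡ e) {m = 2} {k = 3} (λ _ → proj₂) inj fan (grow 3 three-good)))
    where
    Child : Fin n → Set
    Child y = Adj x y × dist y ≡ suc e

    Good : Fin n → Set
    Good y = Child y × (∀ w → dist w ≡ suc e → Adj y w → Adj x w)

    Stray : Fin n → Fin n → Set
    Stray y w = dist w ≡ suc e × Adj y w × ¬ Adj x w

    child : ∀ L → length L < 4 → ∃ λ y → Child y × y ∉ L
    child L lt with neighbour-avoiding x L lt
    ... | y , xy , y∉L with last-neighbour e≡d dx xy
    ...   | inj₁ dy = y , (xy , dy) , y∉L
    ...   | inj₂ dy = contradiction (subst (Adj x) (only dy) xy) irrefl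

    stray-unique : ∀ {y y′ w w′} → Stray y w → Stray y′ w′ → w ≡ w′
    stray-unique {w = w} {w′} (dw , _ , ¬xw) (dw′ , _ , ¬xw′) with w ≟ w′
    ... | yes eq = eq
    -- Two strays and four neighbours of `x` would be six vertices of layer `suc e`.
    ... | no w≢w′ = contradiction (size-≥ (AtLeast-∪ {P = Child} {Q = λ q → ¬ Adj x q × dist q ≡ suc e}
            proj₂ proj₂ (λ (xq , _) (¬xq , _) → ¬xq xq) (grow 4 child)
            (w ∷ w′ ∷ [] , refl , (w≢w′ ∷ []) ∷ [] ∷ [] , (¬xw , dw) ∷ (¬xw′ , dw′) ∷ []))) 6≰s

    stray? : ∀ y w → Dec (Stray y w)
    stray? y w = dist w ℕ.≟ suc e ×-dec (adj? y w ×-dec ¬? (adj? x w))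

    good : ∀ {y} → Child y → (∀ w → ¬ Stray y w) → Good y
    good {y} cy ¬stray = cy , λ w dw yw → decide w dw yw (adj? x w)
      where
      decide : ∀ w → dist w ≡ suc e → Adj y w → Dec (Adj x w) → Adj x w
      decide w dw yw (yes xw) = xw
      decide w dw yw (no ¬xw) = contradiction (dw , yw , ¬xw) (¬stray w)

    three-good : ∀ L → length L < 3 → ∃ λ y → Good y × y ∉ L
    three-good L lt with any? (λ y → (adj? x y) ×-dec any? (stray? y))
    ... | no none =
      let y , cy , y∉ = child L (m≤n⇒m≤1+n lt)
      in y , good cy (λ w st → none (y , proj₁ cy , w , st)) , y∉
    -- All strays coincide, and another child adjacent to this one would share both it and `x` with
    -- `z`. So every child other than `z` is good.
    ... | yes (z , xz , w , st@(dw , zw , _)) =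
      let y , cy , y∉ = child (z ∷ L) (s≤s lt)
          clean = λ w′ st′@(_ , yw′ , _) → y∉ (here (common₂ (layers-≢ dx dw λ ()) (proj₁ cy)
                    (adj-sym (subst (Adj y) (stray-unique st′ st) yw′)) xz (adj-sym zw)))
      in y , good cy clean , λ y∈L → y∉ (there y∈L)

    inj : ∀ {y y′ w} → Good y → Good y′ → Adj y w × dist w ≡ e → Adj y′ w × dist w ≡ e → y ≡ y′
    inj ((xy , _) , _) ((xy′ , _) , _) (yw , dw) (y′w , _) =
      common₂ (layers-≢ dx dw λ ()) xy (adj-sym yw) xy′ (adj-sym y′w)

    fan : ∀ {y} → Good y → AtLeast 2 (λ w → Adj y w × dist w ≡ e)
    fan {y} ((xy , dy) , inside) = grow 2 fresh
      where
      fresh : ∀ L → length L < 2 → ∃ λ w → (Adj y w × dist w ≡ e) × w ∉ L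
      fresh L lt with neighbour-avoiding y (x ∷ common G x y ∷ L) (s≤s (s≤s lt))
      ... | w , yw , w∉ with neighbour-layer dy yw
      ...   | inj₁ dw        = w , (yw , dw) , λ w∈L → w∉ (there (there w∈L))
      ...   | inj₂ (inj₁ dw) =
        contradiction (there (here (common-unique (layers-≢ dx dy λ ()) (inside w dw yw) yw))) w∉
      ...   | inj₂ (inj₂ dw) = contradiction (here (only dw)) w∉

-- Summation over the blocks

-- X ≤ Y follows from a sum P ≤ Q of hypotheses when Y + P exceeds X + Q by k.
linear : ∀ {P Q X Y} k → P ≤ Q → X + Q + k ≡ Y + P → X ≤ Y
linear {P} {Q} {X} {Y} k P≤Q eq = +-cancelʳ-≤ P X Y
  (≤-trans (+-monoʳ-≤ X P≤Q) (≤-trans (m≤m+n (X + Q) k) (≤-reflexive eq)))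

-- The first i sizes have sum S and end a block; the surplus S − 3i is nonnegative and
-- at least m − 4 and k − 4, where m and k are the last two sizes.
Surplus : ℕ → ℕ → ℕ → ℕ → Set
Surplus i S m k = 3 * i ≤ S × 3 * i + m ≤ S + 4 × 3 * i + k ≤ S + 4

block₁ : ∀ i S {m k} t → Surplus i S m k → 3 ≤ t → Surplus (1 + i) (S + t) t m
block₁ i S {m} t (p , q , _) 3≤t =
  linear 0 (+-mono-≤ p 3≤t) (e₁ i S t) ,
  linear 1 p (e₂ i S t) ,
  linear 0 (+-mono-≤ q 3≤t) (e₃ i S t m)
  where
  e₁ : ∀ i S t → 3 * (1 + i) + (S + t) + 0 ≡ S + t + (3 * i + 3)
  e₁ = solve-∀
  e₂ : ∀ i S t → 3 * (1 + i) + t + S + 1 ≡ S + t + 4 + 3 * i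
  e₂ = solve-∀
  e₃ : ∀ i S t m → 3 * (1 + i) + m + (S + 4 + t) + 0 ≡ S + t + 4 + (3 * i + m + 3)
  e₃ = solve-∀

-- The last two sizes both lie in the new block, so their bounds follow from the block and
-- `3 * i ≤ S`; likewise in `block₂₃` and `block₁₄₄`.
block₂ : ∀ i S t → 3 * i ≤ S → 4 ≤ t → Surplus (2 + i) (S + 2 + t) t 2
block₂ i S t p 4≤t =
  linear 0 (+-mono-≤ p 4≤t) (e₁ i S t) ,
  linear 0 p (e₂ i S t) ,
  linear 2 (+-mono-≤ p 4≤t) (e₃ i S t)
  where
  e₁ : ∀ i S t → 3 * (2 + i) + (S + t) + 0 ≡ S + 2 + t + (3 * i + 4)
  e₁ = solve-∀
  e₂ : ∀ i S t → 3 * (2 + i) + t + S + 0 ≡ S + 2 + t + 4 + 3 * i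
  e₂ = solve-∀
  e₃ : ∀ i S t → 3 * (2 + i) + 2 + (S + t) + 2 ≡ S + 2 + t + 4 + (3 * i + 4)
  e₃ = solve-∀

block₂₃ : ∀ i S t → 3 * i ≤ S → 4 ≤ t → Surplus (3 + i) (S + 2 + 3 + t) t 3
block₂₃ i S t p 4≤t =
  linear 0 (+-mono-≤ p 4≤t) (e₁ i S t) ,
  linear 0 p (e₂ i S t) ,
  linear 1 (+-mono-≤ p 4≤t) (e₃ i S t)
  where
  e₁ : ∀ i S t → 3 * (3 + i) + (S + t) + 0 ≡ S + 2 + 3 + t + (3 * i + 4)
  e₁ = solve-∀
  e₂ : ∀ i S t → 3 * (3 + i) + t + S + 0 ≡ S + 2 + 3 + t + 4 + 3 * i
  e₂ = solve-∀
  e₃ : ∀ i S t → 3 * (3 + i) + 3 + (S + t) + 1 ≡ S + 2 + 3 + t + 4 + (3 * i + 4)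
  e₃ = solve-∀

block₁₄₄ : ∀ i S k m → 3 * i ≤ S → 4 ≤ k → 4 ≤ m → Surplus (3 + i) (S + 1 + k + m) m k
block₁₄₄ i S k m p 4≤k 4≤m =
  linear 0 (+-mono-≤ p (+-mono-≤ 4≤k 4≤m)) (e₁ i S k m) ,
  linear 0 (+-mono-≤ p 4≤k) (e₂ i S k m) ,
  linear 0 (+-mono-≤ p 4≤m) (e₃ i S k m)
  where
  e₁ : ∀ i S k m → 3 * (3 + i) + (S + (k + m)) + 0 ≡ S + 1 + k + m + (3 * i + (4 + 4))
  e₁ = solve-∀
  e₂ : ∀ i S k m → 3 * (3 + i) + m + (S + k) + 0 ≡ S + 1 + k + m + 4 + (3 * i + 4)
  e₂ = solve-∀
  e₃ : ∀ i S k m → 3 * (3 + i) + k + (S + m) + 0 ≡ S + 1 + k + m + 4 + (3 * i + 4)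
  e₃ = solve-∀

-- A last layer of size 1 falls short of 3 by 2, and the surplus is at least `6 - 4`. In `final-two`
-- the shortfall is 1 and the surplus at least `5 - 4`.
final-one : ∀ i S {m} → 3 * i + m ≤ S + 4 → 6 ≤ m → 3 * i + 3 ≤ S + 1
final-one i S {m} q 6≤m = linear 0 (+-mono-≤ q 6≤m) (e i S m)
  where
  e : ∀ i S m → 3 * i + 3 + (S + 4 + m) + 0 ≡ S + 1 + (3 * i + m + 6)
  e = solve-∀

final-two : ∀ i S {m} → 3 * i + m ≤ S + 4 → 5 ≤ m → 3 * i + 3 ≤ S + 2
final-two i S {m} q 5≤m = linear 0 (+-mono-≤ q 5≤m) (e i S m)
  where
  e : ∀ i S m → 3 * i + 3 + (S + 4 + m) + 0 ≡ S + 2 + (3 * i + m + 5)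
  e = solve-∀

-- Reading the sizes from left to right.

data Size : ℕ → Set where
  is1  : Size 1
  is2  : Size 2
  is3  : Size 3
  is≥4 : ∀ {k} → 4 ≤ k → Size k

classify : ∀ {k} → 1 ≤ k → Size k
classify {1} _ = is1
classify {2} _ = is2
classify {3} _ = is3
classify {suc (suc (suc (suc k)))} _ = is≥4 (m≤m+n 4 k)

module Blocks (s : ℕ → ℕ) (S : ℕ → ℕ) (S-suc : ∀ i → S (suc i) ≡ S i + s i)
  {d : ℕ} (0<d : 0 < d)
  (root : s 0 ≡ 1) (beyond : s (suc d) ≡ 0) (positive : ∀ {i} → i ≤ d → 1 ≤ s i)
  (one-next : ∀ {i} → i < d → s i ≡ 1 → 4 ≤ s (suc i))
  (one-next-next : ∀ {i} → i < d → s i ≡ 1 → 4 ≤ s (suc (suc i)))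
  (two-next : ∀ {i} → i < d → s i ≡ 2 → 3 ≤ s (suc i))
  (two-three-next : ∀ {i} → i < d → s i ≡ 2 → s (suc i) ≡ 3 → 4 ≤ s (suc (suc i)))
  (last-two : ∀ {e} → suc e ≡ d → s (suc e) ≡ 2 → 5 ≤ s e)
  (last-one : ∀ {e} → suc (suc e) ≡ d → s (suc (suc e)) ≡ 1 → 6 ≤ s (suc e) ⊎ 6 ≤ s e) where

  S₁ : ∀ {i a} → s i ≡ a → S (1 + i) ≡ S i + a
  S₁ {i} refl = S-suc i

  S₂ : ∀ {i a b} → s i ≡ a → s (1 + i) ≡ b → S (2 + i) ≡ S i + a + b
  S₂ {i} p refl = trans (S-suc (1 + i)) (cong (_+ s (1 + i)) (S₁ p))

  S₃ : ∀ {i a b c} → s i ≡ a → s (1 + i) ≡ b → s (2 + i) ≡ c → S (3 + i) ≡ S i + a + b + c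
  S₃ {i} p q refl = trans (S-suc (2 + i)) (cong (_+ s (2 + i)) (S₂ p q))

  -- The index makes the last two layers, `1 + j` and `j`, available. No block ends too early for
  -- this, since the root opens a block of three layers.
  Ended : ℕ → Set
  Ended j = Surplus (2 + j) (S (2 + j)) (s (1 + j)) (s j)

  -- State i: the position, within the block decomposition, reached after i layers.
  data State : ℕ → Set where
    done      : ∀ {j} → Ended j → State (2 + j)
    one       : ∀ {i} → 3 * i ≤ S i → s i ≡ 1 → State (1 + i)
    one-large : ∀ {i} → 3 * i ≤ S i → s i ≡ 1 → 4 ≤ s (suc i) → State (2 + i)
    two       : ∀ {i} → 3 * i ≤ S i → s i ≡ 2 → State (1 + i)
    two-three : ∀ {i} → 3 * i ≤ S i → s i ≡ 2 → s (suc i) ≡ 3 → State (2 + i)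

  end-large : ∀ {j} → Ended j → 3 ≤ s (2 + j) → Ended (1 + j)
  end-large {j} sur 3≤t = subst (λ T → Surplus (3 + j) T (s (2 + j)) (s (1 + j))) (sym (S₁ refl))
    (block₁ (2 + j) (S (2 + j)) (s (2 + j)) sur 3≤t)

  end-one : ∀ {i} → 3 * i ≤ S i → s i ≡ 1 → 4 ≤ s (1 + i) → 4 ≤ s (2 + i) → Ended (1 + i)
  end-one {i} p si≡1 4≤k 4≤m =
    subst (λ T → Surplus (3 + i) T (s (2 + i)) (s (1 + i))) (sym (S₃ si≡1 refl refl))
      (block₁₄₄ i (S i) (s (1 + i)) (s (2 + i)) p 4≤k 4≤m)

  end-two : ∀ {i} → 3 * i ≤ S i → s i ≡ 2 → 4 ≤ s (1 + i) → Ended i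
  end-two {i} p si≡2 4≤m =
    subst (λ T → Surplus (2 + i) T (s (1 + i)) (s i)) (sym (S₂ si≡2 refl))
      (subst (Surplus (2 + i) (S i + 2 + s (1 + i)) (s (1 + i))) (sym si≡2)
        (block₂ i (S i) (s (1 + i)) p 4≤m))

  end-two-three : ∀ {i} → 3 * i ≤ S i → s i ≡ 2 → s (1 + i) ≡ 3 → 4 ≤ s (2 + i) → Ended (1 + i)
  end-two-three {i} p si≡2 si≡3 4≤m =
    subst (λ T → Surplus (3 + i) T (s (2 + i)) (s (1 + i))) (sym (S₃ si≡2 si≡3 refl))
      (subst (Surplus (3 + i) (S i + 2 + 3 + s (2 + i)) (s (2 + i))) (sym si≡3)
        (block₂₃ i (S i) (s (2 + i)) p 4≤m))

  step : ∀ {i} → i < d → State i → State (suc i)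
  step i<d (done {j} sur@(p , _)) with s (2 + j) in eq | classify (positive (<⇒≤ i<d))
  ... | _ | is1      = one p eq
  ... | _ | is2      = two p eq
  ... | _ | is3      = done (end-large sur (≤-reflexive (sym eq)))
  ... | _ | is≥4 4≤t = done (end-large sur (<⇒≤ (subst (4 ≤_) (sym eq) 4≤t)))
  step i<d (one p si≡1) = one-large p si≡1 (one-next (<⇒≤ i<d) si≡1)
  step i<d (one-large p si≡1 4≤k) = done (end-one p si≡1 4≤k (one-next-next (<⇒≤ (<⇒≤ i<d)) si≡1))
  step i<d (two p si≡2) with m≤n⇒m<n∨m≡n (two-next (<⇒≤ i<d) si≡2)
  ... | inj₁ 4≤m = done (end-two p si≡2 4≤m)
  ... | inj₂ 3≡m = two-three p si≡2 (sym 3≡m)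
  step i<d (two-three p si≡2 si≡3) =
    done (end-two-three p si≡2 si≡3 (two-three-next (<⇒≤ (<⇒≤ i<d)) si≡2 si≡3))

  reach : ∀ i → suc i ≤ d → State (suc i)
  reach zero    _   = one z≤n root
  reach (suc i) i<d = step i<d (reach i (<⇒≤ i<d))

  ended-total : ∀ {j} → Ended j → 3 * (1 + j) + 3 ≤ S (2 + j)
  ended-total {j} (p , _) = subst (_≤ S (2 + j)) (e j) p
    where
    e : ∀ j → 3 * (2 + j) ≡ 3 * (1 + j) + 3
    e = solve-∀

  none-beyond : ∀ {i} → i ≡ suc d → ¬ 4 ≤ s i
  none-beyond refl 4≤s = contradiction (subst (4 ≤_) beyond 4≤s) λ ()

  -- The first `d` layers have been read and layer `d` remains. It completes a block, or is a lone
  -- layer of size 1 or 2 paid for by the surplus; otherwise the open block would run past layer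
  -- `d`.
  finish : ∀ {i} → i ≡ d → State i → 3 * i + 3 ≤ S (suc i)
  finish i≡d (done {j} sur@(_ , q , q′)) with s (2 + j) in eq | classify (positive (≤-reflexive i≡d))
  ... | _ | is3      = ended-total (end-large sur (≤-reflexive (sym eq)))
  ... | _ | is≥4 4≤t = ended-total (end-large sur (<⇒≤ (subst (4 ≤_) (sym eq) 4≤t)))
  ... | _ | is2      = subst (_ ≤_) (sym (S₁ eq)) (final-two (2 + j) (S (2 + j)) q (last-two i≡d eq))
  -- Either of the two preceding layers may be the large one, which is why `Surplus` tracks both.
  ... | _ | is1      = subst (_ ≤_) (sym (S₁ eq))
    ([ final-one (2 + j) (S (2 + j)) q , final-one (2 + j) (S (2 + j)) q′ ]′ (last-one i≡d eq))
  -- Layer `d - 1` has size 1 here, which would force four vertices into layer `d + 1`.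
  finish i≡d (one p si≡1) =
    contradiction (one-next-next (≤-reflexive i≡d) si≡1) (none-beyond (cong suc i≡d))
  finish i≡d (one-large p si≡1 4≤k) =
    ended-total (end-one p si≡1 4≤k (one-next-next (<⇒≤ (≤-reflexive i≡d)) si≡1))
  finish i≡d (two p si≡2) with m≤n⇒m<n∨m≡n (two-next (≤-reflexive i≡d) si≡2)
  ... | inj₁ 4≤m = ended-total (end-two p si≡2 4≤m)
  ... | inj₂ 3≡m = contradiction (two-three-next (≤-reflexive i≡d) si≡2 (sym 3≡m)) (none-beyond (cong suc i≡d))
  finish i≡d (two-three p si≡2 si≡3) =
    ended-total (end-two-three p si≡2 si≡3 (two-three-next (<⇒≤ (≤-reflexive i≡d)) si≡2 si≡3))

  three-per-layer : 3 * d + 3 ≤ S (suc d)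
  three-per-layer = bound 0<d refl
    where
    bound : ∀ {i} → 0 < i → i ≡ d → 3 * i + 3 ≤ S (suc i)
    bound {suc i} _ i≡d = finish i≡d (reach i (≤-reflexive i≡d))

-- The bound on `d` is multiplied out to avoid division and truncated subtraction.
theorem2 : (n : ℕ) (G : Graph n) → Connected G → C4Free G →
    (d : ℕ) → HasDiameter G d →
    (λG : ℕ) → IsEdgeConnectivity G λG → 4 ≤ λG →
    3 * d + 3 ≤ n
-- Diameter 0 leaves a single vertex, which no deletion of edges disconnects, contrary to the choice
-- of `F`.
theorem2 n G conn c4-free zero (near , _) λG ((F , _ , disconnected) , _) _ =
  contradiction (λ u v → 0 , trivial (near u v)) disconnected
  where
  trivial : ∀ {u v} → (∃ λ k → k ≤ 0 × Walk (Graph.Adj G) u v k) → Walk (RemoveEdges G F) u v 0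
  trivial (_ , z≤n , nil) = nil
-- The second end of the diametral pair becomes the root `u`, because distances are measured by
-- walks ending at the root.
theorem2 n G conn c4-free d@(suc _) (near , v , u , far) λG (_ , robust) 4≤λ =
  ≤-trans three-per-layer (total≤n (suc d))
  where
  D : Distance G u
  D = distance G conn u
  open Distance D

  dist≤d : ∀ w → dist w ≤ d
  dist≤d w = let k , k≤d , walk = near w u in ≤-trans (dist-least w k walk) k≤d

  open Layers G c4-free (λ F lt → robust F (≤-trans lt 4≤λ)) {v = v} D z<s dist≤d
    (≤-antisym (dist≤d v) (far (dist v) (dist-walk v)))
  open Blocks size total (λ _ → refl) z<s size-root size-beyond size-positive
    one-next one-next-next two-next two-three-next last-two last-one
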